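{- Let $\mathbb{F}_q$ be a finite field with $q$ elements, let $d_1,d_2\ge 1$ be integers, let $P(X,Z)\in\mathbb{F}_q[X,Z]$ be monic in $Z$ with $\deg_Z P\ge 2$, and let $Q(X,Y,Z)\in\mathbb{F}_q[X,Y,Z]$ be monic in $Y$ with $\deg_Y Q\ge 2$. Let $$S_{d_1,d_2}(\mathbb{F}_q)=\{(\alpha,\beta,\gamma,\kappa)\in\mathbb{F}_q^4\mid \alpha^{d_1}\beta=P(\alpha,\gamma),\ \alpha^{d_2}\kappa=Q(\alpha,\beta,\gamma)\}$$ and $$N_0'=\#\{(\beta,\gamma)\in\mathbb{F}_q^2\mid P(0,\gamma)=0,\ Q(0,\beta,\gamma)=0\}.$$ Then $$|S_{d_1,d_2}(\mathbb{F}_q)|=q\bigl(q-1+N_0'\bigr).$$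
   Context: $S_{d_1,d_2}$ is the double Danielewski surface $X^{d_1}Y=P(X,Z)$, $X^{d_2}T=Q(X,Y,Z)$ in affine $4$-space, and $S_{d_1,d_2}(\mathbb{F}_q)$ is its set of $\mathbb{F}_q$-rational points. "Monic in $Z$" means leading coefficient $1$ as a polynomial in $Z$ over the polynomial ring in the other variables; similarly for $Y$. -}

module Defs where

open import Level using (Level; _⊔_) renaming (suc to lsuc)
open import Algebra.Apartness.Bundles
  using (HeytingField; HeytingCommutativeRing)
open import Algebra.Bundles using (CommutativeRing)
open import Algebra.Bundles.Raw using (RawRing)
import Algebra.Definitions.RawSemiring as RawSemiringDefs
open import Data.Fin.Base using (Fin)
import Data.Fin.Properties as Fin
open import Data.List.Base
  using (List; []; _∷_; map; filter; length; tabulate; cartesianProduct)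
open import Data.Nat.Base using (ℕ; zero; suc; _<_)
open import Data.Product.Base using (_×_; _,_)
open import Function.Base using (id)
open import Function.Bundles using (Inverse)
open import Function.Properties.Inverse using (Inverse⇒Injection)
import Function.Properties.Inverse as Inv
open import Relation.Binary.Definitions using (Decidable)
import Relation.Binary.PropositionalEquality.Properties as ≡
import Relation.Unary as U
open import Relation.Nullary.Decidable using (_×-dec_; via-injection)

private
  variable
    a c ℓ ℓ₁ ℓ₂ : Level

------------------------------------------------------------------------
-- Univariate polynomials: a₀ ∷ a₁ ∷ … ∷ aₙ ∷ [] is a₀ + a₁ T + … + aₙ Tⁿ.
-- Trailing zeros are allowed; equality is equality of all coefficients.

module Polynomial (R : RawRing c ℓ) where
  open RawRing R

  coeff : List Carrier → ℕ → Carrier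
  coeff []      _       = 0#
  coeff (x ∷ _) zero    = x
  coeff (_ ∷ p) (suc n) = coeff p n

  add : List Carrier → List Carrier → List Carrier
  add []      q       = q
  add (x ∷ p) []      = x ∷ p
  add (x ∷ p) (y ∷ q) = x + y ∷ add p q

  mul : List Carrier → List Carrier → List Carrier
  mul []      _ = []
  mul (x ∷ p) q = add (map (x *_) q) (0# ∷ mul p q)

  HasDegree : List Carrier → ℕ → Set ℓ
  HasDegree p n = coeff p n ≉ 0# × (∀ m → n < m → coeff p m ≈ 0#)

  MonicOfDegree : List Carrier → ℕ → Set ℓ
  MonicOfDegree p n = HasDegree p n × coeff p n ≈ 1#

infix 9 _[T]

_[T] : RawRing c ℓ → RawRing c ℓ
R [T] = record
  { Carrier = List Carrier
  ; _≈_     = λ p q → ∀ n → coeff p n ≈ coeff q n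
  ; _+_     = add
  ; _*_     = mul
  ; -_      = map -_
  ; 0#      = []
  ; 1#      = 1# ∷ []
  }
  where
  open RawRing R
  open Polynomial R

-- Σᵢ φ(aᵢ) tⁱ, for a map φ from the coefficients into R.
eval : (R : RawRing c ℓ) {A : Set a} →
       (A → RawRing.Carrier R) → RawRing.Carrier R → List A → RawRing.Carrier R
eval R φ t []      = RawRing.0# R
eval R φ t (x ∷ p) = φ x + t * eval R φ t p
  where open RawRing R

------------------------------------------------------------------------
-- As the setoid is finite, equality and invertibility are decidable, so the
-- apartness of the Heyting field is just _≉_ and this is a field in the usual
-- sense.  The carrier is taken up to _≈_, of which there are `order` classes.

record FiniteField c ℓ₁ ℓ₂ : Set (lsuc (c ⊔ ℓ₁ ⊔ ℓ₂)) where
  field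
    heytingField : HeytingField c ℓ₁ ℓ₂

  commutativeRing : CommutativeRing c ℓ₁
  commutativeRing = HeytingCommutativeRing.commutativeRing
    (HeytingField.heytingCommutativeRing heytingField)

  open CommutativeRing commutativeRing public
    using (Carrier; _≈_; _*_; 0#; setoid; rawRing)

  field
    order       : ℕ
    enumeration : Inverse (≡.setoid (Fin order)) setoid

  open RawSemiringDefs (RawRing.rawSemiring rawRing) public using (_^_)

  infix 4 _≟_
  _≟_ : Decidable _≈_
  _≟_ = via-injection (Inverse⇒Injection (Inv.sym enumeration)) Fin._≟_

  -- Every element of the field exactly once, up to _≈_.
  elements : List Carrier
  elements = tabulate (Inverse.to enumeration)

  #² : {P : U.Pred (Carrier × Carrier) ℓ} → U.Decidable P → ℕ
  #² P? = length (filter P? (cartesianProduct elements elements))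

  #⁴ : {P : U.Pred (Carrier × Carrier × Carrier × Carrier) ℓ} → U.Decidable P → ℕ
  #⁴ P? = length (filter P?
    (cartesianProduct elements (cartesianProduct elements
      (cartesianProduct elements elements))))

------------------------------------------------------------------------
-- The polynomial rings are iterated with the variable with respect to which
-- one is monic outermost: F[X,Z] = F[X][Z] and F[X,Y,Z] = F[X][Z][Y].

module DoubleDanielewski (F : FiniteField c ℓ₁ ℓ₂) where
  open FiniteField F

  F[X] F[X][Z] F[X][Z][Y] : RawRing c ℓ₁
  F[X]       = rawRing [T]
  F[X][Z]    = F[X] [T]
  F[X][Z][Y] = F[X][Z] [T]

  module Z = Polynomial F[X]
  module Y = Polynomial F[X][Z]

  evalX : Carrier → RawRing.Carrier F[X] → Carrier
  evalX α = eval rawRing id α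

  evalXZ : Carrier → Carrier → RawRing.Carrier F[X][Z] → Carrier
  evalXZ α γ = eval rawRing (evalX α) γ

  evalXYZ : Carrier → Carrier → Carrier → RawRing.Carrier F[X][Z][Y] → Carrier
  evalXYZ α β γ = eval rawRing (evalXZ α γ) β

  module _ (P : RawRing.Carrier F[X][Z]) (Q : RawRing.Carrier F[X][Z][Y]) where

    IsPoint : (d₁ d₂ : ℕ) → U.Pred (Carrier × Carrier × Carrier × Carrier) ℓ₁
    IsPoint d₁ d₂ (α , β , γ , κ) =
      α ^ d₁ * β ≈ evalXZ α γ P × α ^ d₂ * κ ≈ evalXYZ α β γ Q

    isPoint? : ∀ d₁ d₂ → U.Decidable (IsPoint d₁ d₂)
    isPoint? d₁ d₂ (α , β , γ , κ) =
      (α ^ d₁ * β ≟ evalXZ α γ P) ×-dec (α ^ d₂ * κ ≟ evalXYZ α β γ Q)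

    IsZeroAt0 : U.Pred (Carrier × Carrier) ℓ₁
    IsZeroAt0 (β , γ) = evalXZ 0# γ P ≈ 0# × evalXYZ 0# β γ Q ≈ 0#

    isZeroAt0? : U.Decidable IsZeroAt0
    isZeroAt0? (β , γ) = (evalXZ 0# γ P ≟ 0#) ×-dec (evalXYZ 0# β γ Q ≟ 0#)

    ∣S∣ : (d₁ d₂ : ℕ) → ℕ
    ∣S∣ d₁ d₂ = #⁴ (isPoint? d₁ d₂)

    N₀′ : ℕ
    N₀′ = #² isZeroAt0?

{-# OPTIONS --safe #-}

-- Fibre the surface over the coordinate α.  If α ≠ 0 then α^d is invertible, so
-- for every γ the first equation determines β and then the second one κ: the
-- fibre has q points.  If α = 0 then, as d₁ , d₂ ≥ 1, both left-hand sides
-- vanish and κ is free: the fibre has q N₀′ points.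

module Submission where

open import Defs
open import Algebra.Bundles using (CommutativeRing)
open import Algebra.Bundles.Raw using (RawRing)
open import Algebra.Apartness.Bundles using (HeytingField)
import Algebra.Apartness.Properties.HeytingCommutativeRing as HeytingRing
open import Algebra.Definitions using (LeftInvertible)
import Algebra.Properties.CommutativeSemigroup as CommutativeSemigroup
open import Data.Bool.Base using (true; false; if_then_else_)
open import Data.Fin.Base using (Fin; zero; suc; punchIn)
open import Data.Fin.Properties using (punchInᵢ≢i; any?)
open import Data.List.Base
  using (List; []; _∷_; _++_; map; filter; length; tabulate; cartesianProduct)
open import Data.List.Properties using (filter-++; length-++)
open import Data.Nat.Base using (ℕ; zero; suc; _+_; _*_; _∸_; _≤_)
import Data.Nat.Properties as ℕ
open import Data.Product.Base using (_×_; ∃-syntax; _,_; proj₁)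
open import Function.Base using (_∘_)
open import Function.Bundles using (_⇔_; mk⇔; Inverse)
open import Level using (Level)
open import Relation.Binary.PropositionalEquality.Core
  using (_≡_; _≢_; refl; sym; trans; cong; cong₂)
open import Relation.Binary.PropositionalEquality.Properties using (module ≡-Reasoning)
import Relation.Binary.Reasoning.Setoid as ≈-Reasoning
open import Relation.Nullary using (¬_; Dec; does)
open import Relation.Nullary.Decidable
  using (_×-dec_; does-⇔; dec-true; dec-false; decidable-stable)
open import Relation.Unary using (Pred; Decidable)

open import Algebra.Properties.Semiring.Sum ℕ.+-*-semiring
  using (sum; sum-syntax; sum-cong-≗; sum-remove; ∑-comm; *-distribˡ-sum)

private
  variable
    a b c p r ℓ₁ ℓ₂ : Level
    A : Set a
    B : Set b
    n : ℕ

-- Finite sums and counting by indicator functions.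

∑-const : ∀ n k → ∑[ i < n ] k ≡ n * k
∑-const zero    k = refl
∑-const (suc n) k = cong (k +_) (∑-const n k)

-- The index `i` makes `n` positive, so `n ∸ 1` is a true predecessor: it counts the indices left
-- after `i` is split off.
∑-except : (f : Fin n → ℕ) (i : Fin n) {k : ℕ} →
           (∀ j → j ≢ i → f j ≡ k) → sum f ≡ f i + (n ∸ 1) * k
∑-except {suc n} f i {k} f≡k = begin
  sum f                        ≡⟨ sum-remove {i = i} f ⟩
  f i + sum (f ∘ punchIn i)    ≡⟨ cong (f i +_) (sum-cong-≗ λ j → f≡k _ (punchInᵢ≢i i j)) ⟩
  f i + ∑[ j < n ] k           ≡⟨ cong (f i +_) (∑-const n k) ⟩
  f i + n * k                  ∎
  where open ≡-Reasoning

-- The Iverson bracket, which turns cardinalities into sums that can be reordered and factored.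
⟦_⟧ : {P : Set p} → Dec P → ℕ
⟦ P? ⟧ = if does P? then 1 else 0

⟦⟧-cong : {P : Set p} {R : Set r} → P ⇔ R → (P? : Dec P) (R? : Dec R) → ⟦ P? ⟧ ≡ ⟦ R? ⟧
⟦⟧-cong P⇔R P? R? = cong (if_then 1 else 0) (does-⇔ P⇔R P? R?)

⟦⟧-× : {P : Set p} {R : Set r} (P? : Dec P) (R? : Dec R) → ⟦ P? ×-dec R? ⟧ ≡ ⟦ P? ⟧ * ⟦ R? ⟧
⟦⟧-× P? R? with does P? | does R?
... | false | _     = refl
... | true  | false = refl
... | true  | true  = refl

∑⟦⟧-unique : {P : Pred (Fin n) p} (P? : Decidable P) (i : Fin n) →
             P i → (∀ j → P j → j ≡ i) → ∑[ j < n ] ⟦ P? j ⟧ ≡ 1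
∑⟦⟧-unique {n = n} P? i Pi unique = begin
  ∑[ j < n ] ⟦ P? j ⟧       ≡⟨ ∑-except _ i (λ j j≢i → cong (if_then 1 else 0) (dec-false (P? j) (j≢i ∘ unique j))) ⟩
  ⟦ P? i ⟧ + (n ∸ 1) * 0    ≡⟨ cong₂ _+_ (cong (if_then 1 else 0) (dec-true (P? i) Pi)) (ℕ.*-zeroʳ (n ∸ 1)) ⟩
  1                         ∎
  where open ≡-Reasoning

length-filter-tabulate : {P : Pred A p} (P? : Decidable P) (f : Fin n → A) →
                         length (filter P? (tabulate f)) ≡ ∑[ i < n ] ⟦ P? (f i) ⟧
length-filter-tabulate {n = zero}  P? f = refl
length-filter-tabulate {n = suc n} P? f with does (P? (f zero))
... | true  = cong suc (length-filter-tabulate P? (f ∘ suc))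
... | false = length-filter-tabulate P? (f ∘ suc)

length-filter-map : {P : Pred B p} (P? : Decidable P) (f : A → B) (xs : List A) →
                    length (filter P? (map f xs)) ≡ length (filter (P? ∘ f) xs)
length-filter-map P? f []       = refl
length-filter-map P? f (x ∷ xs) with does (P? (f x))
... | true  = cong suc (length-filter-map P? f xs)
... | false = length-filter-map P? f xs

-- Only the first factor has to be a tabulation; `ys` is arbitrary, so the lemma can be iterated
-- through nested products.
length-filter-cartesianProduct :
  {P : Pred (A × B) p} (P? : Decidable P) (f : Fin n → A) (ys : List B) →
  length (filter P? (cartesianProduct (tabulate f) ys)) ≡
  ∑[ i < n ] length (filter (λ y → P? (f i , y)) ys)
length-filter-cartesianProduct {n = zero}  P? f ys = refl
length-filter-cartesianProduct {n = suc n} P? f ys = begin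
  length (filter P? (xs ++ zs))                    ≡⟨ cong length (filter-++ P? xs zs) ⟩
  length (filter P? xs ++ filter P? zs)            ≡⟨ length-++ (filter P? xs) ⟩
  length (filter P? xs) + length (filter P? zs)    ≡⟨ cong₂ _+_ (length-filter-map P? (f zero ,_) ys)
                                                                (length-filter-cartesianProduct P? (f ∘ suc) ys) ⟩
  ∑[ i < suc n ] length (filter (λ y → P? (f i , y)) ys) ∎
  where
  open ≡-Reasoning
  xs = map (f zero ,_) ys
  zs = cartesianProduct (tabulate (f ∘ suc)) ys

-- Units, linear equations and point counts over a finite field.

module FiniteFieldProperties (F : FiniteField c ℓ₁ ℓ₂) where
  open FiniteField F using (heytingField; commutativeRing; order; enumeration; _≟_; _^_; #²; #⁴)
  private module R = CommutativeRing commutativeRing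
  open R using (Carrier; _≈_; _≉_; 0#; 1#) renaming (_*_ to _·_)
  open HeytingField heytingField using (#⇒invertible; tight; heytingCommutativeRing)
  open HeytingRing heytingCommutativeRing using (x-0≈x)
  open Inverse enumeration using (strictlyInverseˡ; inverseʳ)
    renaming (to to e; from to index)

  Unit : Pred Carrier _
  Unit = LeftInvertible _≈_ 1# _·_

  -- A Heyting field only gives ¬ ¬ (x # 0#); searching for an inverse among the
  -- finitely many elements removes the double negation.
  ≉0⇒unit : ∀ {x} → x ≉ 0# → Unit x
  ≉0⇒unit {x} x≉0 = let (i , eq) = decidable-stable (any? λ i → e i · x ≟ 1#) ¬¬∃ in e i , eq
    where
    ¬¬∃ : ¬ ¬ (∃[ i ] e i · x ≈ 1#)
    ¬¬∃ ∄ = x≉0 (proj₁ (tight x 0#) λ x#0 →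
      let (y , y[x-0]≈1 , _) = #⇒invertible x#0 in
      ∄ (index y , R.trans (R.*-cong (strictlyInverseˡ y) (R.sym (x-0≈x x))) y[x-0]≈1))

  -- The inverse of a power is assembled one factor at a time; commutativity pairs each factor with
  -- its inverse.
  ^-unit : ∀ {x} d → Unit x → Unit (x ^ d)
  ^-unit zero    _             = 1# , R.*-identityˡ 1#
  ^-unit {x} (suc d) ux@(y , yx≈1) =
    let (z , zxᵈ≈1) = ^-unit d ux in
    y · z , (begin
      (y · z) · (x · x ^ d)  ≈⟨ interchange y z x (x ^ d) ⟩
      (y · x) · (z · x ^ d)  ≈⟨ R.*-cong yx≈1 zxᵈ≈1 ⟩
      1# · 1#                ≈⟨ R.*-identityˡ 1# ⟩
      1#                     ∎)
    where
    open ≈-Reasoning R.setoid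
    open CommutativeSemigroup R.*-commutativeSemigroup using (interchange)

  -- A positive exponent exposes a factor `x`; for exponent zero the power would be `1#`, even at
  -- `0#`.
  ≈0⇒^·≈0 : ∀ {x d} → 1 ≤ d → x ≈ 0# → ∀ y → x ^ d · y ≈ 0#
  ≈0⇒^·≈0 {x} {suc d} _ x≈0 y = begin
    (x · x ^ d) · y   ≈⟨ R.*-congʳ (R.*-congʳ x≈0) ⟩
    (0# · x ^ d) · y  ≈⟨ R.*-congʳ (R.zeroˡ _) ⟩
    0# · y            ≈⟨ R.zeroˡ y ⟩
    0#                ∎
    where open ≈-Reasoning R.setoid

  -- Multiplying by the inverse `v` shows that `v · w` is the only solution up to `≈`, and each
  -- class has exactly one index.
  ∑-linear-equation : ∀ {u} → Unit u → ∀ w → ∑[ i < order ] ⟦ u · e i ≟ w ⟧ ≡ 1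
  ∑-linear-equation {u} (v , vu≈1) w = ∑⟦⟧-unique (λ i → u · e i ≟ w) (index (v · w)) solution
    -- `inverseʳ` converts uniqueness up to `≈` in the field into equality of indices.
    λ j eq → sym (inverseʳ (R.sym (unique eq)))
    where
    open ≈-Reasoning R.setoid
    solution : u · e (index (v · w)) ≈ w
    solution = begin
      u · e (index (v · w))  ≈⟨ R.*-congˡ (strictlyInverseˡ (v · w)) ⟩
      u · (v · w)            ≈⟨ R.*-assoc u v w ⟨
      (u · v) · w            ≈⟨ R.*-congʳ (R.*-comm u v) ⟩
      (v · u) · w            ≈⟨ R.*-congʳ vu≈1 ⟩
      1# · w                 ≈⟨ R.*-identityˡ w ⟩
      w                      ∎
    unique : ∀ {x} → u · x ≈ w → x ≈ v · w
    unique {x} ux≈w = begin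
      x            ≈⟨ R.*-identityˡ x ⟨
      1# · x       ≈⟨ R.*-congʳ vu≈1 ⟨
      (v · u) · x  ≈⟨ R.*-assoc v u x ⟩
      v · (u · x)  ≈⟨ R.*-congˡ ux≈w ⟩
      v · w        ∎

  #²≡∑ : {P : Pred (Carrier × Carrier) ℓ₁} (P? : Decidable P) →
         #² P? ≡ ∑[ i < order ] ∑[ j < order ] ⟦ P? (e i , e j) ⟧
  #²≡∑ P? = trans (length-filter-cartesianProduct P? e _)
    (sum-cong-≗ λ i → length-filter-tabulate (λ y → P? (e i , y)) e)

  #⁴≡∑ : {P : Pred (Carrier × Carrier × Carrier × Carrier) ℓ₁} (P? : Decidable P) →
         #⁴ P? ≡ ∑[ i < order ] ∑[ j < order ] ∑[ k < order ] ∑[ l < order ]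
                   ⟦ P? (e i , e j , e k , e l) ⟧
  #⁴≡∑ P? =
    trans (length-filter-cartesianProduct P? e _) (sum-cong-≗ λ i →
    trans (length-filter-cartesianProduct (λ y → P? (e i , y)) e _) (sum-cong-≗ λ j →
    #²≡∑ (λ y → P? (e i , e j , y))))

  -- The coefficient map varies along with the point, so the lemma can be nested through the
  -- iterated polynomial rings, where `α` enters at the innermost level.
  eval-cong : {φ ψ : A → Carrier} {s t : Carrier} → (∀ x → φ x ≈ ψ x) → s ≈ t →
              ∀ f → eval R.rawRing φ s f ≈ eval R.rawRing ψ t f
  eval-cong φ≈ψ s≈t []      = R.refl
  eval-cong φ≈ψ s≈t (x ∷ f) = R.+-cong (φ≈ψ x) (R.*-cong s≈t (eval-cong φ≈ψ s≈t f))

-- Fibres over the first coordinate and the total count.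

module Fibres (F : FiniteField c ℓ₁ ℓ₂)
  (P : RawRing.Carrier (DoubleDanielewski.F[X][Z] F))
  (Q : RawRing.Carrier (DoubleDanielewski.F[X][Z][Y] F))
  (d₁ d₂ : ℕ) where
  open DoubleDanielewski F
  open FiniteField F using (commutativeRing; order; enumeration; _≟_; _^_)
  open FiniteFieldProperties F
  private module R = CommutativeRing commutativeRing
  open R using (Carrier; _≈_; _≉_; 0#) renaming (_*_ to _·_)
  open Inverse enumeration using (strictlyInverseˡ; inverseʳ)
    renaming (to to e; from to index)
  open ≡-Reasoning

  fibre : Carrier → ℕ
  fibre α = ∑[ j < order ] ∑[ k < order ] ∑[ l < order ] ⟦ isPoint? P Q d₁ d₂ (α , e j , e k , e l) ⟧

  fibre-≉0 : ∀ {α} → α ≉ 0# → fibre α ≡ order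
  fibre-≉0 {α} α≉0 = begin
    fibre α
      ≡⟨ (sum-cong-≗ λ j → sum-cong-≗ λ k → ∑κ j k) ⟩
    ∑[ j < order ] ∑[ k < order ] ⟦ first j k ⟧
      -- The first equation is linear in β but not in γ, so the sum over β has to be the inner one.
      ≡⟨ ∑-comm (λ j k → ⟦ first j k ⟧) ⟩
    ∑[ k < order ] ∑[ j < order ] ⟦ first j k ⟧
      ≡⟨ (sum-cong-≗ λ k → ∑-linear-equation (^-unit d₁ (≉0⇒unit α≉0)) (evalXZ α (e k) P)) ⟩
    ∑[ k < order ] 1
      ≡⟨ ∑-const order 1 ⟩
    order * 1
      ≡⟨ ℕ.*-identityʳ order ⟩
    order ∎
    where
    first : ∀ j k → Dec (α ^ d₁ · e j ≈ evalXZ α (e k) P)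
    first j k = α ^ d₁ · e j ≟ evalXZ α (e k) P

    second : ∀ j k l → Dec (α ^ d₂ · e l ≈ evalXYZ α (e j) (e k) Q)
    second j k l = α ^ d₂ · e l ≟ evalXYZ α (e j) (e k) Q

    -- The first equation does not involve κ, so its bracket factors out; what remains counts the
    -- solutions of a linear equation in κ with unit coefficient.
    ∑κ : ∀ j k → ∑[ l < order ] ⟦ isPoint? P Q d₁ d₂ (α , e j , e k , e l) ⟧ ≡ ⟦ first j k ⟧
    ∑κ j k = begin
      ∑[ l < order ] ⟦ first j k ×-dec second j k l ⟧
        ≡⟨ (sum-cong-≗ λ l → ⟦⟧-× (first j k) (second j k l)) ⟩
      ∑[ l < order ] (⟦ first j k ⟧ * ⟦ second j k l ⟧)
        ≡⟨ *-distribˡ-sum ⟦ first j k ⟧ (λ l → ⟦ second j k l ⟧) ⟨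
      ⟦ first j k ⟧ * ∑[ l < order ] ⟦ second j k l ⟧
        ≡⟨ cong (⟦ first j k ⟧ *_) (∑-linear-equation (^-unit d₂ (≉0⇒unit α≉0)) _) ⟩
      ⟦ first j k ⟧ * 1
        ≡⟨ ℕ.*-identityʳ _ ⟩
      ⟦ first j k ⟧ ∎

  module _ (1≤d₁ : 1 ≤ d₁) (1≤d₂ : 1 ≤ d₂) where

    -- Both left-hand sides vanish, leaving the conditions on `P` and `Q`. The hypothesis is
    -- `α ≈ 0#` because the enumeration meets zero only up to `≈`; the values of `P` and `Q` are
    -- transported along it.
    isPoint⇔isZeroAt0 : ∀ {α} → α ≈ 0# → ∀ β γ κ →
                        IsPoint P Q d₁ d₂ (α , β , γ , κ) ⇔ IsZeroAt0 P Q (β , γ)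
    isPoint⇔isZeroAt0 {α} α≈0 β γ κ = mk⇔
      (λ (p , q) → R.trans (R.sym P≈) (R.trans (R.sym p) (≈0⇒^·≈0 1≤d₁ α≈0 β))
                 , R.trans (R.sym Q≈) (R.trans (R.sym q) (≈0⇒^·≈0 1≤d₂ α≈0 κ)))
      (λ (p , q) → R.trans (≈0⇒^·≈0 1≤d₁ α≈0 β) (R.sym (R.trans P≈ p))
                 , R.trans (≈0⇒^·≈0 1≤d₂ α≈0 κ) (R.sym (R.trans Q≈ q)))
      where
      evalXZ≈ : ∀ f → evalXZ α γ f ≈ evalXZ 0# γ f
      evalXZ≈ = eval-cong (eval-cong (λ _ → R.refl) α≈0) R.refl

      P≈ : evalXZ α γ P ≈ evalXZ 0# γ P
      P≈ = evalXZ≈ P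

      Q≈ : evalXYZ α β γ Q ≈ evalXYZ 0# β γ Q
      Q≈ = eval-cong evalXZ≈ R.refl Q

    fibre-≈0 : ∀ {α} → α ≈ 0# → fibre α ≡ order * N₀′ P Q
    fibre-≈0 {α} α≈0 = begin
      fibre α
        ≡⟨ (sum-cong-≗ λ j → sum-cong-≗ λ k → trans
              -- The condition no longer depends on κ, so the inner sum is constant and contributes
              -- a factor `order`.
              (sum-cong-≗ λ l → ⟦⟧-cong (isPoint⇔isZeroAt0 α≈0 (e j) (e k) (e l)) (isPoint? P Q d₁ d₂ _) (zero? j k))
              (∑-const order ⟦ zero? j k ⟧)) ⟩
      ∑[ j < order ] ∑[ k < order ] (order * ⟦ zero? j k ⟧)
        ≡⟨ (sum-cong-≗ λ j → *-distribˡ-sum order (λ k → ⟦ zero? j k ⟧)) ⟨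
      ∑[ j < order ] (order * ∑[ k < order ] ⟦ zero? j k ⟧)
        ≡⟨ *-distribˡ-sum order (λ j → ∑[ k < order ] ⟦ zero? j k ⟧) ⟨
      order * ∑[ j < order ] ∑[ k < order ] ⟦ zero? j k ⟧
        ≡⟨ cong (order *_) (#²≡∑ (isZeroAt0? P Q)) ⟨
      order * N₀′ P Q ∎
      where
      zero? : ∀ j k → Dec (IsZeroAt0 P Q (e j , e k))
      zero? j k = isZeroAt0? P Q (e j , e k)

    ∣S∣≡ : ∣S∣ P Q d₁ d₂ ≡ order * (order ∸ 1 + N₀′ P Q)
    ∣S∣≡ = begin
      ∣S∣ P Q d₁ d₂
        ≡⟨ #⁴≡∑ (isPoint? P Q d₁ d₂) ⟩
      ∑[ i < order ] fibre (e i)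
        -- Only the index `0̂` enumerates the class of zero, so each of the other `order ∸ 1` fibres
        -- has `order` points.
        ≡⟨ ∑-except (fibre ∘ e) 0̂ (λ i i≢0̂ → fibre-≉0 λ ei≈0 →
             i≢0̂ (sym (inverseʳ (R.sym ei≈0)))) ⟩
      fibre (e 0̂) + (order ∸ 1) * order
        ≡⟨ cong₂ _+_ (fibre-≈0 (strictlyInverseˡ 0#)) (ℕ.*-comm (order ∸ 1) order) ⟩
      order * N₀′ P Q + order * (order ∸ 1)
        ≡⟨ ℕ.*-distribˡ-+ order (N₀′ P Q) (order ∸ 1) ⟨
      order * (N₀′ P Q + (order ∸ 1))
        ≡⟨ cong (order *_) (ℕ.+-comm (N₀′ P Q) (order ∸ 1)) ⟩
      order * (order ∸ 1 + N₀′ P Q) ∎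
      where 0̂ = index 0#

corollary4p3 : ∀ {c ℓ₁ ℓ₂} (F : FiniteField c ℓ₁ ℓ₂) →
    let open DoubleDanielewski F
        q = FiniteField.order F
    in
    (d₁ d₂ : ℕ) → 1 ≤ d₁ → 1 ≤ d₂ →
    (P : RawRing.Carrier F[X][Z]) →
    (∃[ n ] (2 ≤ n × Z.MonicOfDegree P n)) →
    (Q : RawRing.Carrier F[X][Z][Y]) →
    (∃[ n ] (2 ≤ n × Y.MonicOfDegree Q n)) →
    ∣S∣ P Q d₁ d₂ ≡ q * (q ∸ 1 + N₀′ P Q)
corollary4p3 F d₁ d₂ 1≤d₁ 1≤d₂ P _ Q _ = Fibres.∣S∣≡ F P Q d₁ d₂ 1≤d₁ 1≤d₂
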